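{- For positive integers $n$ (as $n\to\infty$), there exists a family of digraphs, each with at most $n$ vertices, such that the core of the tensor product of the family has $\Omega\left(n^{\frac{2^{\sqrt n}}{\sqrt n}}\right)$ vertices.
   Context: All digraphs are finite, without loops and parallel arcs; digons (pairs of opposite arcs) are allowed. A homomorphism is a vertex map sending arcs to arcs. The tensor product of a finite family of digraphs has as vertex set the Cartesian product, with an arc from $(u_i)_i$ to $(v_i)_i$ iff $u_i\to v_i$ is an arc in every coordinate. The core of a digraph $G$ is the digraph with the fewest vertices that is homomorphically equivalent to $G$ (homomorphisms exist in both directions); it is unique up to isomorphism. The order of a digraph is its number of vertices. -}

module Defs where

open import Data.Fin using (Fin; zero; suc)
open import Data.Fin.Properties using (1↔⊤; *↔×; all?)
open import Data.Nat using (ℕ; zero; suc; _+_; _*_; _^_; _≤_; NonZero)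
open import Data.Product using (Σ; ∃; ∃₂; _×_; _,_)
open import Data.Product.Function.NonDependent.Propositional using (_×-↔_)
open import Data.Unit using (⊤)
open import Function using (_∘_; _↔_)
open import Function.Properties.Inverse using (↔-sym; ↔-trans)
open import Relation.Binary using (Rel; Decidable; Irreflexive)
open import Relation.Binary.Morphism.Structures using (IsRelHomomorphism)
open import Relation.Binary.PropositionalEquality using (_≡_; refl)
open import Level using (0ℓ)

------------------------------------------------------------------------
-- Digraphs

-- Arcs form a relation, so there are no parallel arcs; digons are allowed.
record Digraph : Set₁ where
  infix 4 _⟶_
  field
    Vertex      : Set
    order       : ℕ
    enumeration : Vertex ↔ Fin order
    _⟶_         : Rel Vertex 0ℓ
    _⟶?_        : Decidable _⟶_
    loopless    : Irreflexive _≡_ _⟶_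

open Digraph using (Vertex; order; enumeration; loopless) public

infix 4 _⇒_ _⇄_

_⇒_ : Digraph → Digraph → Set
G ⇒ H = Σ (Vertex G → Vertex H) (IsRelHomomorphism (Digraph._⟶_ G) (Digraph._⟶_ H))

_⇄_ : Digraph → Digraph → Set
G ⇄ H = (G ⇒ H) × (H ⇒ G)

-- H is the core of G (which is determined only up to isomorphism).
IsCoreOf : Digraph → Digraph → Set₁
IsCoreOf H G = H ⇄ G × (∀ K → K ⇄ G → order H ≤ order K)

------------------------------------------------------------------------
-- Tensor products of finite families

-- The Cartesian product of a finite family of sets, as nested pairs rather
-- than functions (i : Fin k) → A i, so that equality of tuples is _≡_
-- without function extensionality.
Tuple : ∀ {k} → (Fin k → Set) → Set
Tuple {zero}  A = ⊤
Tuple {suc k} A = A zero × Tuple (A ∘ suc)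

coord : ∀ {k} (A : Fin k → Set) → Tuple A → (i : Fin k) → A i
coord A (a , as) zero    = a
coord A (a , as) (suc i) = coord (A ∘ suc) as i

∏ : ∀ {k} → (Fin k → ℕ) → ℕ
∏ {zero}  f = 1
∏ {suc k} f = f zero * ∏ (f ∘ suc)

Tuple↔Fin : ∀ {k} {A : Fin k → Set} {f : Fin k → ℕ} →
            (∀ i → A i ↔ Fin (f i)) → Tuple A ↔ Fin (∏ f)
Tuple↔Fin {zero}  e = ↔-sym 1↔⊤
Tuple↔Fin {suc k} e = ↔-trans (e zero ×-↔ Tuple↔Fin (e ∘ suc)) (↔-sym *↔×)

-- The family is nonempty: the empty product would be a single loop, which is
-- not a digraph in the sense above.
⨂ : ∀ {k} → (Fin (suc k) → Digraph) → Digraph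
⨂ G = record
  { Vertex      = Tuple V
  ; order       = ∏ (λ i → order (G i))
  ; enumeration = Tuple↔Fin (λ i → enumeration (G i))
  ; _⟶_         = λ u v → ∀ i → Digraph._⟶_ (G i) (coord V u i) (coord V v i)
  ; _⟶?_        = λ u v → all? (λ i → Digraph._⟶?_ (G i) (coord V u i) (coord V v i))
  ; loopless    = λ { refl u⟶u → loopless (G zero) refl (u⟶u zero) }
  }
  where
  V : _ → Set
  V i = Vertex (G i)

------------------------------------------------------------------------
-- Nonnegative fractions

-- p /suc d is p / (1 + d).  Numerators are natural numbers (unlike in ℚᵘ)
-- because fractions also serve as exponents.
infix 8 _/suc_
infix 4 _≤ᶠ_

record Frac : Set where
  constructor _/suc_
  field
    num   : ℕ
    den-1 : ℕ

  den : ℕ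
  den = suc den-1

open Frac public

_≤ᶠ_ : Rel Frac 0ℓ
r ≤ᶠ s = num r * den s ≤ num s * den r

infixl 7 _*ᶠ_

_*ᶠ_ : Frac → Frac → Frac
r *ᶠ s = (num r * num s) /suc (den-1 s + den-1 r * den s)

fromℕᶠ : ℕ → Frac
fromℕᶠ m = m /suc 0

infixr 8 _^ᶠ_

_^ᶠ_ : Frac → ℕ → Frac
r ^ᶠ zero  = fromℕᶠ 1
r ^ᶠ suc d = r *ᶠ r ^ᶠ d

------------------------------------------------------------------------
-- Nonnegative reals

-- A nonnegative real x is presented by a set of fractions with supremum x
-- and a set of fractions with infimum x.  Each operation below preserves
-- this, so x ≤ y holds iff each lower fraction of x is at most each upper
-- fraction of y.
record Real : Set₁ where
  field
    Lower : Frac → Set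
    Upper : Frac → Set

open Real public

infix  4 _≤ᴿ_
infixl 7 _*ᴿ_ _÷ᴿ_
infixr 8 _^ᴿ_

_≤ᴿ_ : Real → Real → Set
x ≤ᴿ y = ∀ r s → Lower x r → Upper y s → r ≤ᶠ s

fromFrac : Frac → Real
fromFrac q .Lower r = r ≤ᶠ q
fromFrac q .Upper r = q ≤ᶠ r

fromℕ : ℕ → Real
fromℕ m = fromFrac (fromℕᶠ m)

√ : ℕ → Real
√ n .Lower r = r ^ᶠ 2 ≤ᶠ fromℕᶠ n
√ n .Upper r = fromℕᶠ n ≤ᶠ r ^ᶠ 2

_*ᴿ_ : Real → Real → Real
(x *ᴿ y) .Lower r = ∃₂ λ s t → Lower x s × Lower y t × r ≤ᶠ s *ᶠ t
(x *ᴿ y) .Upper r = ∃₂ λ s t → Upper x s × Upper y t × s *ᶠ t ≤ᶠ r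

-- Meaningful for y > 0 only.
_÷ᴿ_ : Real → Real → Real
(x ÷ᴿ y) .Lower r = ∃₂ λ s t → Lower x s × Upper y t × r *ᶠ t ≤ᶠ s
(x ÷ᴿ y) .Upper r = ∃₂ λ s t → Upper x s × Lower y t × s ≤ᶠ r *ᶠ t

-- k ^ x for k ≥ 1, which is monotone and continuous in x; r ≤ k ^ (a/b) is
-- expressed as r ^ b ≤ k ^ a.
_^ᴿ_ : (k : ℕ) .{{_ : NonZero k}} → Real → Real
(k ^ᴿ x) .Lower r = ∃ λ s → Lower x s × r ^ᶠ den s ≤ᶠ fromℕᶠ (k ^ num s)
(k ^ᴿ x) .Upper r = ∃ λ s → Upper x s × fromℕᶠ (k ^ num s) ≤ᶠ r ^ᶠ den s

-- For each word w over {strong, weak} there is a digraph A w of order linear in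
-- |w| in which the oriented walk shape w (a strong letter is →, a weak one is
-- →←→) starts nowhere, while one lower vertex, the root, starts shape v for
-- every v in the same antichain of words, v ≠ w.  Let the factors be the
-- disjoint unions A (0u) + A (1u), over all 2^t binary words u (encoded as an
-- antichain).  Picking one of the two roots in each factor gives 2^(2^t)
-- vertices of the product.  Such a vertex starts shape (0u) or shape (1u),
-- according to the root picked in factor u, because every coordinate does.
-- Endomorphisms preserve this, and no vertex of factor u starts both walks, so
-- every endomorphism is injective on these vertices.  An endomorphism through
-- the core is no exception, hence the core has at least 2^(2^t) vertices.
-- Since the order of a factor is only 20 + 8t, t can be taken linear in n,
-- which exceeds the required bound by far.

module Submission where

open import Defs
open import Data.Bool using (Bool; true; false; T)
open import Data.Bool.Properties using (T?)
open import Data.Fin using (Fin; zero; suc; toℕ; finToFun; funToFin)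
open import Data.Fin.Properties
  using (*↔×; 2↔Bool; all?; any?; finToFun-funToFin; injective⇒≤; toℕ≤pred[n])
open import Data.List using (List; []; _∷_)
open import Data.Nat
  using (ℕ; zero; suc; _+_; _*_; _^_; _/_; _%_; _≤_; _<_; z≤n; s≤s; s≤s⁻¹; z<s; NonZero)
open import Data.Nat.DivMod using (m≡m%n+[m/n]*n; m%n≤n; m/n*n≤m; /-monoˡ-≤)
open import Data.Nat.Induction using (<-rec)
open import Data.Nat.Properties
open import Data.Nat.Tactic.RingSolver using (solve-∀)
open import Data.Product using (Σ; ∃-syntax; _×_; _,_; proj₁; proj₂)
open import Data.Product.Function.NonDependent.Propositional using (_×-↔_)
open import Data.Unit using (⊤; tt)
open import Data.Vec using (Vec; []; _∷_)
open import Data.Vec.Relation.Unary.All using (All; []; _∷_)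
open import Function using (_∘_; _↔_; Inverse; Injective; case_of_)
open import Function.Bundles using (module Injection)
open import Function.Properties.Inverse using (↔-refl; ↔-sym; ↔-trans; ↔⇒↣)
open import Level using (0ℓ)
open import Relation.Binary.Morphism.Structures using (IsRelHomomorphism)
open import Relation.Binary.PropositionalEquality
  using (_≡_; _≢_; refl; sym; trans; cong; cong₂; subst; subst₂; module ≡-Reasoning)
open import Relation.Nullary using (¬_; yes; no; contradiction)
open import Relation.Nullary.Decidable using (_→-dec_)
open import Relation.Unary using (Pred; Decidable)

-- Existence of cores

least : ∀ {P : Pred ℕ 0ℓ} → Decidable P → ∀ n → P n →
        ∃[ m ] P m × (∀ k → P k → m ≤ k)
least {P} P? = <-rec _ λ n rec Pn → case anyUpTo? P? n of λ where
  (yes (m , m<n , Pm)) → rec m<n Pm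
  (no ¬P<n)            → n , Pn , λ k Pk → ≮⇒≥ λ k<n → ¬P<n (k , k<n , Pk)

module _ (G : Digraph) where
  private
    open Digraph G using (_⟶_; _⟶?_)
    open Inverse (enumeration G) using (to; from; strictlyInverseʳ)

    -- e ∘ r is an endomorphism of G through m points.  The functions are
    -- coded by elements of finite sets to make their existence decidable.
    FactorsThrough : ℕ → Set
    FactorsThrough m =
      ∃[ e ] ∃[ r ] (∀ u v → from u ⟶ from v →
        through e r u ⟶ through e r v)
      where
      through : Fin (order G ^ m) → Fin (m ^ order G) → Fin (order G) → Vertex G
      through e r u = from (finToFun e (finToFun r u))

    factorsThrough? : Decidable FactorsThrough
    factorsThrough? m = any? λ e → any? λ r → all? λ u → all? λ v →
      (_ ⟶? _) →-dec (_ ⟶? _)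

    ⇄⇒factorsThrough : ∀ K → K ⇄ G → FactorsThrough (order K)
    ⇄⇒factorsThrough K ((f , f-hom) , (g , g-hom)) =
      funToFin e , funToFin r , λ u v u⟶v →
        subst₂ _⟶_ (sym (er u)) (sym (er v))
          (IsRelHomomorphism.cong f-hom (IsRelHomomorphism.cong g-hom u⟶v))
      where
      module K = Inverse (enumeration K)
      e : Fin (order K) → Fin (order G)
      e = to ∘ f ∘ K.from
      r : Fin (order G) → Fin (order K)
      r = K.to ∘ g ∘ from
      er : ∀ u → from (finToFun (funToFin e) (finToFun (funToFin r) u)) ≡ f (g (from u))
      er u = begin
        from (finToFun (funToFin e) (finToFun (funToFin r) u))
          ≡⟨ cong from (finToFun-funToFin e _) ⟩
        from (e (finToFun (funToFin r) u))
          ≡⟨ cong (from ∘ e) (finToFun-funToFin r u) ⟩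
        from (e (r u))
          ≡⟨ strictlyInverseʳ _ ⟩
        f (K.from (r u))
          ≡⟨ cong f (K.strictlyInverseʳ _) ⟩
        f (g (from u)) ∎
        where open ≡-Reasoning

  -- The least m for which an endomorphism factors through m points gives the core. The arcs of `G`
  -- are pulled back along `include`, so `include` is a homomorphism by definition and `retract` is
  -- one because the composite is.
  core-exists : ∃[ H ] IsCoreOf H G
  core-exists with least factorsThrough? (order G) (⇄⇒factorsThrough G (id⇒ , id⇒))
    where
    id⇒ : G ⇒ G
    id⇒ = (λ v → v) , record { cong = λ uv → uv }
  ... | m , (e , r , er-hom) , minimal =
    H , ((include , record { cong = λ uv → uv }) ,
         (retract , record { cong = λ {u} {v} uv → er-hom (to u) (to v)
           (subst₂ _⟶_ (sym (strictlyInverseʳ u)) (sym (strictlyInverseʳ v)) uv) })) ,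
        λ K K⇄G → minimal (order K) (⇄⇒factorsThrough K K⇄G)
    where
    include : Fin m → Vertex G
    include = from ∘ finToFun e
    retract : Vertex G → Fin m
    retract = finToFun r ∘ to
    H : Digraph
    H = record
      { Vertex      = Fin m
      ; order       = m
      ; enumeration = ↔-refl
      ; _⟶_         = λ u v → include u ⟶ include v
      ; _⟶?_        = λ u v → include u ⟶? include v
      ; loopless    = λ { refl → loopless G refl }
      }

-- Tuples

tabulate : ∀ {k} (A : Fin k → Set) → (∀ i → A i) → Tuple A
tabulate {zero}  A f = tt
tabulate {suc k} A f = f zero , tabulate (A ∘ suc) (f ∘ suc)

coord-tabulate : ∀ {k} (A : Fin k → Set) (f : ∀ i → A i) i →
                 coord A (tabulate A f) i ≡ f i
coord-tabulate A f zero    = refl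
coord-tabulate A f (suc i) = coord-tabulate (A ∘ suc) (f ∘ suc) i

tuple-ext : ∀ {k} (A : Fin k → Set) {x y : Tuple A} →
            (∀ i → coord A x i ≡ coord A y i) → x ≡ y
tuple-ext {zero}  A eq = refl
tuple-ext {suc k} A eq = cong₂ _,_ (eq zero) (tuple-ext (A ∘ suc) (eq ∘ suc))

Bits : ℕ → Set
Bits t = Tuple {t} (λ _ → Bool)

∏-const : ∀ k m → ∏ {k} (λ _ → m) ≡ m ^ k
∏-const zero    m = refl
∏-const (suc k) m = cong (m *_) (∏-const k m)

Bits↔Fin : ∀ t → Bits t ↔ Fin (2 ^ t)
Bits↔Fin t = subst (λ m → Bits t ↔ Fin m) (∏-const t 2) (Tuple↔Fin (λ _ → ↔-sym 2↔Bool))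

-- Oriented walks

data Step : Set where
  fwd bwd : Step

Traverse : (G : Digraph) → Step → Vertex G → Vertex G → Set
Traverse G fwd u v = Digraph._⟶_ G u v
Traverse G bwd u v = Digraph._⟶_ G v u

Admits : (G : Digraph) → List Step → Vertex G → Set
Admits G []      u = ⊤
Admits G (d ∷ s) u = ∃[ v ] Traverse G d u v × Admits G s v

admits-hom : ∀ G H ((f , _) : G ⇒ H) s {u} → Admits G s u → Admits H s (f u)
admits-hom G H f               []        _               = tt
admits-hom G H F@(f , f-hom) (fwd ∷ s) (v , uv , walk) =
  f v , IsRelHomomorphism.cong f-hom uv , admits-hom G H F s walk
admits-hom G H F@(f , f-hom) (bwd ∷ s) (v , uv , walk) =
  f v , IsRelHomomorphism.cong f-hom uv , admits-hom G H F s walk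

module _ {k} (G : Fin (suc k) → Digraph) where
  private
    V : Fin (suc k) → Set
    V i = Vertex (G i)

  proj⇒ : ∀ i → ⨂ G ⇒ G i
  proj⇒ i = (λ u → coord V u i) , record { cong = λ uv → uv i }

  -- All coordinate walks follow the same directions, so their vertices at each time assemble to a
  -- tuple, and these tuples form a walk in the product.
  admits-⨂ : ∀ s {u} → (∀ i → Admits (G i) s (coord V u i)) → Admits (⨂ G) s u
  admits-⨂ []      _     = tt
  admits-⨂ (d ∷ s) {u} walks = next , traverse d (proj₁ ∘ proj₂ ∘ walks) ,
    admits-⨂ s λ i → subst (Admits (G i) s) (sym (coord-next i)) (proj₂ (proj₂ (walks i)))
    where
    next : Tuple V
    next = tabulate V (proj₁ ∘ walks)
    coord-next : ∀ i → coord V next i ≡ proj₁ (walks i)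
    coord-next = coord-tabulate V (proj₁ ∘ walks)
    traverse : ∀ d → (∀ i → Traverse (G i) d (coord V u i) (proj₁ (walks i))) →
               Traverse (⨂ G) d u next
    traverse fwd uv i = subst (Traverse (G i) fwd _) (sym (coord-next i)) (uv i)
    traverse bwd uv i = subst (Traverse (G i) bwd _) (sym (coord-next i)) (uv i)

-- Separating graphs

data Gate : Set where
  opening strong weak : Gate

-- The final `fwd` tests the side: the arc to the top level exists on the upper side only.
shape : ∀ {m} → Vec Gate m → List Step
shape []             = fwd ∷ []
shape (opening ∷ gs) = fwd ∷ shape gs
shape (strong  ∷ gs) = fwd ∷ shape gs
shape (weak    ∷ gs) = fwd ∷ bwd ∷ fwd ∷ shape gs

-- Vertices are pairs (side, level), where true is the upper side.  Arcs raise
-- the level by one.  The only way up is the walk →←→ of a weak letter at a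
-- strong gate, and only the upper side passes the last level.  The opening
-- gate cuts off the upper vertex of level 0, which would start every shape.
gateArc : Gate → Bool → Bool → Bool
gateArc _       false false = true
gateArc opening true  true  = false
gateArc _       true  true  = true
gateArc strong  true  false = true
gateArc _       _     _     = false

Layered : ℕ → Set
Layered m = Bool × Fin (2 + m)

arc : ∀ {m} → Vec Gate m → Layered m → Layered m → Bool
arc []       (true , zero)  (true , suc zero) = true
arc (g ∷ gs) (b , zero)     (b′ , suc zero)   = gateArc g b b′
arc (g ∷ gs) (b , suc i)    (b′ , suc j)      = arc gs (b , i) (b′ , j)
arc _        _              _                 = false

arc-level : ∀ {m} (gs : Vec Gate m) {b b′ i j} → T (arc gs (b , i) (b′ , j)) →
            toℕ j ≡ suc (toℕ i)
arc-level []       {true} {true} {zero}  {suc zero} _  = refl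
arc-level (g ∷ gs) {i = zero}  {suc zero} _  = refl
arc-level (g ∷ gs) {i = suc i} {suc j}    ij = cong suc (arc-level gs ij)

¬arc-zero : ∀ {m} (gs : Vec Gate m) {b b′ i} → ¬ T (arc gs (b , i) (b′ , zero))
¬arc-zero gs ij = case arc-level gs ij of λ ()

A : ∀ {m} → Vec Gate m → Digraph
A {m} gs = record
  { Vertex      = Layered m
  ; order       = 2 * (2 + m)
  ; enumeration = ↔-trans (↔-sym 2↔Bool ×-↔ ↔-refl) (↔-sym *↔×)
  ; _⟶_         = λ u v → T (arc gs u v)
  ; _⟶?_        = λ u v → T? (arc gs u v)
  ; loopless    = λ { refl uu → 1+n≢n (sym (arc-level gs uu)) }
  }

-- Every letter has net height one and the final step adds one more; the end cannot exceed the top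
-- level `suc m`.
admits⇒level+length≤ : ∀ {m n} (gs : Vec Gate m) (hs : Vec Gate n) {b} {i : Fin (2 + m)} →
                       Admits (A gs) (shape hs) (b , i) → toℕ i + n ≤ m
admits⇒level+length≤ {m} gs [] {i = i} ((_ , j) , ij , _) =
  s≤s⁻¹ (subst (_≤ suc m) (trans (arc-level gs ij) (cong suc (sym (+-identityʳ (toℕ i)))))
    (toℕ≤pred[n] j))
admits⇒level+length≤ {m} {suc n} gs (opening ∷ hs) {i = i} (_ , ij , walk) =
  subst (_≤ m) (trans (cong (_+ n) (arc-level gs ij)) (sym (+-suc (toℕ i) n)))
    (admits⇒level+length≤ gs hs walk)
admits⇒level+length≤ {m} {suc n} gs (strong ∷ hs) {i = i} (_ , ij , walk) =
  subst (_≤ m) (trans (cong (_+ n) (arc-level gs ij)) (sym (+-suc (toℕ i) n)))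
    (admits⇒level+length≤ gs hs walk)
admits⇒level+length≤ {m} {suc n} gs (weak ∷ hs) {i = i} (_ , ij , _ , kj , _ , kl , walk) =
  subst (_≤ m) (trans (cong (_+ n) level) (sym (+-suc (toℕ i) n)))
    (admits⇒level+length≤ gs hs walk)
  where
  level = trans (arc-level gs kl) (trans (sym (arc-level gs kj)) (arc-level gs ij))

-- Walks of the given shapes never descend below their start.
descend : ∀ {m n} g (gs : Vec Gate m) (hs : Vec Gate n) {b i} →
          Admits (A (g ∷ gs)) (shape hs) (b , suc i) → Admits (A gs) (shape hs) (b , i)
descend g gs []             ((b , suc j) , ij , _)    = (b , j) , ij , tt
descend g gs (opening ∷ hs) ((b , suc j) , ij , walk) = (b , j) , ij , descend g gs hs walk
descend g gs (strong  ∷ hs) ((b , suc j) , ij , walk) = (b , j) , ij , descend g gs hs walk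
-- Stepping back to level zero would require the first arc to end at level one, but it starts there
-- or higher.
descend g gs (weak    ∷ hs) ((_ , suc zero) , ij , (_ , zero) , _) =
  contradiction ij (¬arc-zero gs)
descend g gs (weak    ∷ hs) ((b , suc j) , ij , (c , suc k) , kj , (d , suc l) , kl , walk) =
  (b , j) , ij , (c , k) , kj , (d , l) , kl , descend g gs hs walk

ascend : ∀ {m} g (gs : Vec Gate m) s {b i} →
         Admits (A gs) s (b , i) → Admits (A (g ∷ gs)) s (b , suc i)
ascend g gs []        _                   = tt
ascend g gs (fwd ∷ s) ((b , j) , ij , walk) = (b , suc j) , ij , ascend g gs s walk
ascend g gs (bwd ∷ s) ((b , j) , ij , walk) = (b , suc j) , ij , ascend g gs s walk

-- A walk gets from the lower to the upper side only where a weak letter meets a strong gate. Here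
-- letters and gates coincide, so it stays on the lower side, where the last arc is missing.
¬admits-own-lower : ∀ {m} (gs : Vec Gate m) → ¬ Admits (A gs) (shape gs) (false , zero)
¬admits-own-lower []             ((false , zero)  , () , _)
¬admits-own-lower []             ((false , suc _) , () , _)
¬admits-own-lower []             ((true  , zero)  , () , _)
¬admits-own-lower []             ((true  , suc _) , () , _)
¬admits-own-lower (opening ∷ gs) ((false , suc zero) , _ , walk) =
  ¬admits-own-lower gs (descend opening gs gs walk)
¬admits-own-lower (strong ∷ gs) ((false , suc zero) , _ , walk) =
  ¬admits-own-lower gs (descend strong gs gs walk)
¬admits-own-lower (weak ∷ gs)
  ((false , suc zero) , _ , (false , zero) , _ , (false , suc zero) , _ , walk) =
  ¬admits-own-lower gs (descend weak gs gs walk)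
¬admits-own-lower (weak ∷ gs) ((false , suc zero) , _ , (_ , suc _) , kj , _) =
  contradiction kj (¬arc-zero gs)

¬admits-own : ∀ {m} (gs : Vec Gate m) u → ¬ Admits (A (opening ∷ gs)) (shape (opening ∷ gs)) u
¬admits-own gs (false , zero) walk = ¬admits-own-lower (opening ∷ gs) walk
¬admits-own gs (true , zero) ((false , suc zero) , () , _)
¬admits-own gs (true , zero) ((true  , suc zero) , () , _)
-- A start above level zero leaves too few levels for the whole shape.
¬admits-own gs (b , suc i) walk =
  m+n≮n (toℕ i) _ (admits⇒level+length≤ (opening ∷ gs) (opening ∷ gs) {b} {suc i} walk)

Passable : Gate → Set
Passable g = T (gateArc g true true)

-- The walk runs straight up the upper side, a weak letter going back and forth over a single arc.
admits-upper : ∀ {m} {gs : Vec Gate m} → All Passable gs → (hs : Vec Gate m) →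
               Admits (A gs) (shape hs) (true , zero)
admits-upper {gs = []}     []       []             = (true , suc zero) , tt , tt
admits-upper {gs = g ∷ gs} (p ∷ ps) (opening ∷ hs) =
  (true , suc zero) , p , ascend g gs (shape hs) (admits-upper ps hs)
admits-upper {gs = g ∷ gs} (p ∷ ps) (strong ∷ hs) =
  (true , suc zero) , p , ascend g gs (shape hs) (admits-upper ps hs)
admits-upper {gs = g ∷ gs} (p ∷ ps) (weak ∷ hs) =
  (true , suc zero) , p , (true , zero) , p ,
  (true , suc zero) , p , ascend g gs (shape hs) (admits-upper ps hs)

-- The first vector holds the gates of the graph, the second the letters of the walk. `here` marks a
-- place to change sides; the passable gates after it keep the way to the top open.
data Separated : ∀ {m} → Vec Gate m → Vec Gate m → Set where
  here  : ∀ {m} {gs hs : Vec Gate m} → All Passable gs → Separated (strong ∷ gs) (weak ∷ hs)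
  there : ∀ {m g h} {gs hs : Vec Gate m} → Separated gs hs → Separated (g ∷ gs) (h ∷ hs)

lower-arc : ∀ g → T (gateArc g false false)
lower-arc opening = tt
lower-arc strong  = tt
lower-arc weak    = tt

admits-separated : ∀ {m} {gs hs : Vec Gate m} → Separated gs hs →
                   Admits (A gs) (shape hs) (false , zero)
admits-separated {gs = _ ∷ gs} {_ ∷ hs} (here ps) =
  -- The change of sides: up on the lower side, back along the extra arc of the strong gate to the
  -- upper side, and up again.
  (false , suc zero) , tt , (true , zero) , tt ,
  (true , suc zero) , tt , ascend strong gs (shape hs) (admits-upper ps hs)
admits-separated {gs = g ∷ gs} {opening ∷ hs} (there sep) =
  (false , suc zero) , lower-arc g , ascend g gs (shape hs) (admits-separated sep)
admits-separated {gs = g ∷ gs} {strong ∷ hs} (there sep) =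
  (false , suc zero) , lower-arc g , ascend g gs (shape hs) (admits-separated sep)
admits-separated {gs = g ∷ gs} {weak ∷ hs} (there sep) =
  (false , suc zero) , lower-arc g , (false , zero) , lower-arc g ,
  (false , suc zero) , lower-arc g , ascend g gs (shape hs) (admits-separated sep)

-- Two gates per bit make the codes of distinct words an antichain.
gates : ∀ {t} → Bits t → Vec Gate (t * 2)
gates {zero}  _           = []
gates {suc t} (true  , w) = strong ∷ weak ∷ gates w
gates {suc t} (false , w) = weak ∷ strong ∷ gates w

gates-passable : ∀ {t} (w : Bits t) → All Passable (gates w)
gates-passable {zero}  _           = []
gates-passable {suc t} (true  , w) = tt ∷ tt ∷ gates-passable w
gates-passable {suc t} (false , w) = tt ∷ tt ∷ gates-passable w

gates-separated : ∀ {t} {v w : Bits t} → v ≢ w → Separated (gates v) (gates w)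
gates-separated {zero} v≢w = contradiction refl v≢w
gates-separated {suc t} {true  , v} {true  , w} v≢w =
  there (there (gates-separated (v≢w ∘ cong (true ,_))))
gates-separated {suc t} {false , v} {false , w} v≢w =
  there (there (gates-separated (v≢w ∘ cong (false ,_))))
-- At the first differing bit, strong faces weak in the first gate of the pair in this case and in
-- the second gate in the next case.
gates-separated {suc t} {true  , v} {false , w} v≢w = here (tt ∷ gates-passable v)
gates-separated {suc t} {false , v} {true  , w} v≢w = there (here (gates-passable v))

code : ∀ {t} → Bits t → Vec Gate (1 + t * 2)
code w = opening ∷ gates w

-- Disjoint unions and the factors

infix 5 _⊕_

_⊕_ : ∀ {m} → Vec Gate m → Vec Gate m → Digraph
_⊕_ {m} gs hs = record
  { Vertex      = Bool × Layered m
  ; order       = 2 * (2 * (2 + m))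
  ; enumeration = ↔-trans (↔-sym 2↔Bool ×-↔ enumeration (A gs)) (↔-sym *↔×)
  ; _⟶_         = λ u v → T (arc⊕ u v)
  ; _⟶?_        = λ u v → T? (arc⊕ u v)
  ; loopless    = λ { {false , _} refl → loopless (A gs) refl
                    ; {true  , _} refl → loopless (A hs) refl }
  }
  where
  arc⊕ : Bool × Layered m → Bool × Layered m → Bool
  arc⊕ (false , u) (false , v) = arc gs u v
  arc⊕ (true  , u) (true  , v) = arc hs u v
  arc⊕ _           _           = false

module _ {m} (gs : Bool → Vec Gate m) where

  admits-⊕ : ∀ s b {u} → Admits (A (gs b)) s u → Admits (gs false ⊕ gs true) s (b , u)
  admits-⊕ []        _     _               = tt
  admits-⊕ (fwd ∷ s) false (v , uv , walk) = (false , v) , uv , admits-⊕ s false walk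
  admits-⊕ (bwd ∷ s) false (v , uv , walk) = (false , v) , uv , admits-⊕ s false walk
  admits-⊕ (fwd ∷ s) true  (v , uv , walk) = (true  , v) , uv , admits-⊕ s true walk
  admits-⊕ (bwd ∷ s) true  (v , uv , walk) = (true  , v) , uv , admits-⊕ s true walk

  admits-⊕⁻¹ : ∀ s b {u} → Admits (gs false ⊕ gs true) s (b , u) → Admits (A (gs b)) s u
  admits-⊕⁻¹ []        _     _                         = tt
  admits-⊕⁻¹ (fwd ∷ s) false ((false , v) , uv , walk) = v , uv , admits-⊕⁻¹ s false walk
  admits-⊕⁻¹ (bwd ∷ s) false ((false , v) , uv , walk) = v , uv , admits-⊕⁻¹ s false walk
  admits-⊕⁻¹ (fwd ∷ s) true  ((true  , v) , uv , walk) = v , uv , admits-⊕⁻¹ s true walk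
  admits-⊕⁻¹ (bwd ∷ s) true  ((true  , v) , uv , walk) = v , uv , admits-⊕⁻¹ s true walk

prefixed : ∀ {t} → Bits t → Bool → Vec Gate (1 + suc t * 2)
prefixed w b = code (b , w)

factor : ∀ {t} → Bits t → Digraph
factor w = prefixed w false ⊕ prefixed w true

-- The vertex lies in one of the two summands, and no vertex there starts that summand's own shape.
¬admits-both : ∀ {t} (w : Bits t) u →
               Admits (factor w) (shape (prefixed w false)) u →
               ¬ Admits (factor w) (shape (prefixed w true)) u
¬admits-both w (false , u) walk _ =
  ¬admits-own (gates (false , w)) u (admits-⊕⁻¹ (prefixed w) (shape (prefixed w false)) false walk)
¬admits-both w (true , u) _ walk =
  ¬admits-own (gates (true , w)) u (admits-⊕⁻¹ (prefixed w) (shape (prefixed w true)) true walk)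

admits-other : ∀ {t} (v w : Bits t) b c → (b , v) ≢ (c , w) →
               Admits (factor v) (shape (prefixed w c)) (b , false , zero)
admits-other v w b c ≢ =
  admits-⊕ (prefixed v) (shape (prefixed w c)) b
    (admits-separated {gs = prefixed v b} {prefixed w c} (there (gates-separated ≢)))

-- Large cores

module _ {k t} (word : Fin (suc k) → Bits t) (word-injective : Injective _≡_ _≡_ word) where
  private
    G : Fin (suc k) → Digraph
    G i = factor (word i)

    V : Fin (suc k) → Set
    V i = Vertex (G i)

    bit : Bits (suc k) → Fin (suc k) → Bool
    bit = coord (λ _ → Bool)

    root : Bits (suc k) → Vertex (⨂ G)
    root x = tabulate V (λ i → bit x i , false , zero)

    -- Every coordinate starts the walk: in factor `i` the prefixed bits differ, and in any other
    -- factor the words differ by injectivity of `word`.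
    admits-root : ∀ x i c → bit x i ≢ c → Admits (⨂ G) (shape (prefixed (word i) c)) (root x)
    admits-root x i c ≢c = admits-⨂ G (shape (prefixed (word i) c)) λ j →
      subst (Admits (G j) (shape (prefixed (word i) c)))
        (sym (coord-tabulate V (λ j → bit x j , false , zero) j))
        (admits-other (word j) (word i) (bit x j) c λ eq →
          ≢c (trans (cong (bit x) (sym (word-injective (cong proj₂ eq)))) (cong proj₁ eq)))

    module _ (φ : ⨂ G ⇒ ⨂ G) where

      admits-image : ∀ x i c → bit x i ≢ c →
                     Admits (G i) (shape (prefixed (word i) c)) (coord V (proj₁ φ (root x)) i)
      admits-image x i c ≢c =
        admits-hom (⨂ G) (G i) (proj⇒ G i) walk {proj₁ φ (root x)}
          (admits-hom (⨂ G) (⨂ G) φ walk {root x} (admits-root x i c ≢c))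
        where
        walk = shape (prefixed (word i) c)

      -- A common image would start both shapes of factor `i` in coordinate `i`, one inherited from
      -- `x` and the other from `y`.
      images-differ : ∀ x y i → bit x i ≡ true → bit y i ≡ false →
                      proj₁ φ (root x) ≢ proj₁ φ (root y)
      images-differ x y i xi yi φx≡φy =
        ¬admits-both (word i) (coord V (proj₁ φ (root y)) i)
          (subst (λ z → Admits (G i) (shape (prefixed (word i) false)) (coord V z i)) φx≡φy
            (admits-image x i false λ e → case trans (sym xi) e of λ ()))
          (admits-image y i true λ e → case trans (sym yi) e of λ ())

      images-agree⇒bits-agree : ∀ x y → proj₁ φ (root x) ≡ proj₁ φ (root y) →
                                ∀ i → bit x i ≡ bit y i
      images-agree⇒bits-agree x y φx≡φy i with bit x i in xi | bit y i in yi
      ... | false | false = refl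
      ... | true  | true  = refl
      ... | true  | false = contradiction φx≡φy (images-differ x y i xi yi)
      ... | false | true  = contradiction (sym φx≡φy) (images-differ y x i yi xi)

  -- The endomorphism `f ∘ g` is injective on the roots, hence so is `g`, which maps them into `K`.
  2^[1+k]≤order : ∀ K → K ⇄ ⨂ G → 2 ^ suc k ≤ order K
  2^[1+k]≤order K ((f , f-hom) , (g , g-hom)) = injective⇒≤ {f = embed} λ {a} {b} eq →
    Injection.injective (↔⇒↣ (↔-sym (Bits↔Fin (suc k))))
      (tuple-ext _ (images-agree⇒bits-agree endo _ _
        (cong f (Injection.injective (↔⇒↣ (enumeration K)) eq))))
    where
    embed : Fin (2 ^ suc k) → Fin (order K)
    embed a = Inverse.to (enumeration K) (g (root (Inverse.from (Bits↔Fin (suc k)) a)))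
    endo : ⨂ G ⇒ ⨂ G
    endo = f ∘ g , record
      { cong = λ uv → IsRelHomomorphism.cong f-hom (IsRelHomomorphism.cong g-hom uv) }

  order-core : ∃[ H ] IsCoreOf H (⨂ G) × 2 ^ suc k ≤ order H
  order-core =
    let H , H-core@(H⇄⨂G , _) = core-exists (⨂ G)
    in  H , H-core , 2^[1+k]≤order H H⇄⨂G

large-core : ∀ t → ∃[ k ] Σ (Fin (suc k) → Digraph) λ G →
             (∀ i → order (G i) ≡ 20 + 8 * t) ×
             ∃[ H ] IsCoreOf H (⨂ G) × 2 ^ (2 ^ t) ≤ order H
-- The number of words is exposed as a successor because families are indexed by `Fin (suc k)`;
-- positivity rules out zero.
large-core t with 2 ^ t | m^n>0 2 t | Bits↔Fin t
... | suc k | _ | words = k , factor ∘ word , (λ _ → order-factor t) ,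
      order-core word (Injection.injective (↔⇒↣ (↔-sym words)))
  where
  word = Inverse.from words
  order-factor : ∀ t → 2 * (2 * (2 + (1 + suc t * 2))) ≡ 20 + 8 * t
  order-factor = solve-∀

-- Fractions

^-cancelʳ-≤ : ∀ d .{{_ : NonZero d}} {a b} → a ^ d ≤ b ^ d → a ≤ b
^-cancelʳ-≤ d a^d≤b^d = ≮⇒≥ λ b<a → ≤⇒≯ a^d≤b^d (^-monoˡ-< d b<a)

^-distribʳ-* : ∀ d a b → (a * b) ^ d ≡ a ^ d * b ^ d
^-distribʳ-* zero    a b = refl
^-distribʳ-* (suc d) a b = trans (cong (a * b *_) (^-distribʳ-* d a b))
  ([m*n]*[o*p]≡[m*o]*[n*p] a b (a ^ d) (b ^ d))

num-^ : ∀ r d → num (r ^ᶠ d) ≡ num r ^ d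
num-^ r zero    = refl
num-^ r (suc d) = cong (num r *_) (num-^ r d)

den-^ : ∀ r d → den (r ^ᶠ d) ≡ den r ^ d
den-^ r zero    = refl
den-^ r (suc d) = cong (den r *_) (den-^ r d)

≤ᶠ-trans : ∀ r s t → r ≤ᶠ s → s ≤ᶠ t → r ≤ᶠ t
≤ᶠ-trans r s t r≤s s≤t = *-cancelʳ-≤ (num r * den t) (num t * den r) (den s) (begin
  num r * den t * den s ≡⟨ swap (num r) (den t) (den s) ⟩
  num r * den s * den t ≤⟨ *-monoˡ-≤ (den t) r≤s ⟩
  num s * den r * den t ≡⟨ swap (num s) (den r) (den t) ⟩
  num s * den t * den r ≤⟨ *-monoˡ-≤ (den r) s≤t ⟩
  num t * den s * den r ≡⟨ swap (num t) (den s) (den r) ⟩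
  num t * den r * den s ∎)
  where
  open ≤-Reasoning
  swap : ∀ x y z → x * y * z ≡ x * z * y
  swap = solve-∀

*ᶠ-mono-≤ : ∀ r r′ s s′ → r ≤ᶠ r′ → s ≤ᶠ s′ → r *ᶠ s ≤ᶠ r′ *ᶠ s′
*ᶠ-mono-≤ r r′ s s′ r≤r′ s≤s′ = subst₂ _≤_
  ([m*n]*[o*p]≡[m*o]*[n*p] (num r) (den r′) (num s) (den s′))
  ([m*n]*[o*p]≡[m*o]*[n*p] (num r′) (den r) (num s′) (den s))
  (*-mono-≤ r≤r′ s≤s′)

r≤r*s : ∀ r s → fromℕᶠ 1 ≤ᶠ s → r ≤ᶠ r *ᶠ s
r≤r*s r s 1≤s = begin
  num r * (den r * den s) ≡⟨ rearrange (num r) (den r) (den s) ⟩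
  num r * (1 * den s) * den r ≤⟨ *-monoˡ-≤ (den r) (*-monoʳ-≤ (num r) 1≤s) ⟩
  num r * (num s * 1) * den r ≡⟨ cong (λ m → num r * m * den r) (*-identityʳ (num s)) ⟩
  num r * num s * den r ∎
  where
  open ≤-Reasoning
  rearrange : ∀ a b c → a * (b * c) ≡ a * (1 * c) * b
  rearrange = solve-∀

^ᶠ-cancel-≤ : ∀ r d .{{_ : NonZero d}} m → r ^ᶠ d ≤ᶠ fromℕᶠ (m ^ d) → r ≤ᶠ fromℕᶠ m
^ᶠ-cancel-≤ r d m r^d≤m^d = ^-cancelʳ-≤ d (begin
  (num r * 1) ^ d         ≡⟨ cong (_^ d) (*-identityʳ (num r)) ⟩
  num r ^ d               ≡⟨ num-^ r d ⟨
  num (r ^ᶠ d)            ≡⟨ *-identityʳ _ ⟨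
  num (r ^ᶠ d) * 1        ≤⟨ r^d≤m^d ⟩
  m ^ d * den (r ^ᶠ d)    ≡⟨ cong (m ^ d *_) (den-^ r d) ⟩
  m ^ d * den r ^ d       ≡⟨ ^-distribʳ-* d m (den r) ⟨
  (m * den r) ^ d         ∎)
  where open ≤-Reasoning

^ᶠ-cancel-1≤ : ∀ r d .{{_ : NonZero d}} → fromℕᶠ 1 ≤ᶠ r ^ᶠ d → fromℕᶠ 1 ≤ᶠ r
^ᶠ-cancel-1≤ r d 1≤r^d = ^-cancelʳ-≤ d (begin
  (1 * den r) ^ d   ≡⟨ cong (_^ d) (*-identityˡ (den r)) ⟩
  den r ^ d         ≡⟨ den-^ r d ⟨
  den (r ^ᶠ d)      ≡⟨ *-identityˡ _ ⟨
  1 * den (r ^ᶠ d)  ≤⟨ 1≤r^d ⟩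
  num (r ^ᶠ d) * 1  ≡⟨ cong (_* 1) (num-^ r d) ⟩
  num r ^ d * 1     ≡⟨ *-identityʳ _ ⟩
  num r ^ d         ≡⟨ cong (_^ d) (*-identityʳ (num r)) ⟨
  (num r * 1) ^ d   ∎)
  where open ≤-Reasoning

fromℕᶠ-mono-≤ : ∀ a b → a ≤ b → fromℕᶠ a ≤ᶠ fromℕᶠ b
fromℕᶠ-mono-≤ a b a≤b = *-monoˡ-≤ 1 a≤b

-- Nonnegative reals

-- Stated through lower fractions, which are what `_≤ᴿ_` takes from its left side.
_BoundedBy_ : Real → ℕ → Set
x BoundedBy m = ∀ r → Lower x r → r ≤ᶠ fromℕᶠ m

-- A lower fraction `s` of `x` satisfies `num s ≤ m * den s`, so the `den s`-th power of `r` is at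
-- most that of `k ^ m`.
^-bounded : ∀ k .{{_ : NonZero k}} x m → x BoundedBy m → (k ^ᴿ x) BoundedBy (k ^ m)
^-bounded k x m x≤m r (s , s∈x , r^d≤k^n) = ^ᶠ-cancel-≤ r (den s) (k ^ m)
  (≤ᶠ-trans (r ^ᶠ den s) (fromℕᶠ (k ^ num s)) (fromℕᶠ ((k ^ m) ^ den s)) r^d≤k^n
    (fromℕᶠ-mono-≤ (k ^ num s) ((k ^ m) ^ den s) (begin
      k ^ num s        ≤⟨ ^-monoʳ-≤ k (subst (_≤ m * den s) (*-identityʳ (num s)) (x≤m s s∈x)) ⟩
      k ^ (m * den s)  ≡⟨ ^-*-assoc k m (den s) ⟨
      (k ^ m) ^ den s  ∎)))
  where open ≤-Reasoning

√-bounded : ∀ n m → n ≤ m ^ 2 → √ n BoundedBy m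
√-bounded n m n≤m² r r²≤n = ^ᶠ-cancel-≤ r 2 m
  (≤ᶠ-trans (r ^ᶠ 2) (fromℕᶠ n) (fromℕᶠ (m ^ 2)) r²≤n (fromℕᶠ-mono-≤ n (m ^ 2) n≤m²))

1≤√ : ∀ n .{{_ : NonZero n}} → fromℕ 1 ≤ᴿ √ n
1≤√ n@(suc _) r s r≤1 n≤s² = ≤ᶠ-trans r (fromℕᶠ 1) s r≤1 (^ᶠ-cancel-1≤ s 2
  (≤ᶠ-trans (fromℕᶠ 1) (fromℕᶠ n) (s ^ᶠ 2) (fromℕᶠ-mono-≤ 1 n (s≤s z≤n)) n≤s²))

-- Each upper fraction `t` of `y` is at least 1, so `r` is at most `r *ᶠ t`, which is at most a
-- lower fraction of `x`.
÷-bounded : ∀ x y m → x BoundedBy m → fromℕ 1 ≤ᴿ y → (x ÷ᴿ y) BoundedBy m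
÷-bounded x y m x≤m 1≤y r (s , t , s∈x , t∈y , rt≤s) =
  ≤ᶠ-trans r (r *ᶠ t) (fromℕᶠ m) (r≤r*s r t (1≤y (fromℕᶠ 1) t ≤-refl t∈y))
    (≤ᶠ-trans (r *ᶠ t) s (fromℕᶠ m) rt≤s (x≤m s s∈x))

1*x≤ᴿ : ∀ x {m} l → x BoundedBy m → m ≤ l → fromFrac (fromℕᶠ 1) *ᴿ x ≤ᴿ fromℕ l
1*x≤ᴿ x {m} l x≤m m≤l r u (s , t , s≤1 , t∈x , r≤st) l≤u =
  ≤ᶠ-trans r (fromℕᶠ l) u (≤ᶠ-trans r (fromℕᶠ m) (fromℕᶠ l)
    (≤ᶠ-trans r (s *ᶠ t) (fromℕᶠ m) r≤st
      (subst (λ k → s *ᶠ t ≤ᶠ fromℕᶠ k) (*-identityˡ m)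
        (*ᶠ-mono-≤ s (fromℕᶠ 1) t (fromℕᶠ m) s≤1 (x≤m t t∈x))))
    (fromℕᶠ-mono-≤ m l m≤l))
    l≤u

target-bounded : ∀ n .{{_ : NonZero n}} q → n ≤ q ^ 2 →
                 (n ^ᴿ (2 ^ᴿ √ n ÷ᴿ √ n)) BoundedBy (n ^ (2 ^ q))
target-bounded n q n≤q² =
  ^-bounded n (2 ^ᴿ √ n ÷ᴿ √ n) (2 ^ q)
    (÷-bounded (2 ^ᴿ √ n) (√ n) (2 ^ q)
      (^-bounded 2 (√ n) q (√-bounded n q n≤q²)) (1≤√ n))

-- Numerical estimates and choice of parameters

n<2^n : ∀ n → n < 2 ^ n
n<2^n zero    = z<s
n<2^n (suc n) = begin-strict
  suc n            ≤⟨ n<2^n n ⟩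
  2 ^ n            <⟨ m<m*n (2 ^ n) 2 {{m^n≢0 2 n}} (s≤s (s≤s z≤n)) ⟩
  2 ^ n * 2        ≡⟨ *-comm (2 ^ n) 2 ⟩
  2 ^ suc n        ∎
  where open ≤-Reasoning

-- The bound `q ≤ 2 ^ q` is used twice: first in the base, then for the factor `q` that this brings
-- into the exponent.
n^2^q≤2^2^[1+2q] : ∀ n q → n ≤ q ^ 2 → n ^ (2 ^ q) ≤ 2 ^ (2 ^ (1 + 2 * q))
n^2^q≤2^2^[1+2q] n q n≤q² = begin
  n ^ (2 ^ q)              ≤⟨ ^-monoˡ-≤ (2 ^ q) n≤q² ⟩
  (q ^ 2) ^ (2 ^ q)        ≤⟨ ^-monoˡ-≤ (2 ^ q) (^-monoˡ-≤ 2 q≤2^q) ⟩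
  ((2 ^ q) ^ 2) ^ (2 ^ q)  ≡⟨ cong (_^ (2 ^ q)) (^-*-assoc 2 q 2) ⟩
  (2 ^ (q * 2)) ^ (2 ^ q)  ≡⟨ ^-*-assoc 2 (q * 2) (2 ^ q) ⟩
  2 ^ (q * 2 * 2 ^ q)      ≤⟨ ^-monoʳ-≤ 2 (*-monoˡ-≤ (2 ^ q) (*-monoˡ-≤ 2 q≤2^q)) ⟩
  2 ^ (2 ^ q * 2 * 2 ^ q)  ≡⟨ cong (2 ^_) (square (2 ^ q)) ⟩
  2 ^ (2 * (2 ^ q) ^ 2)    ≡⟨ cong (λ m → 2 ^ (2 * m)) (^-*-assoc 2 q 2) ⟩
  2 ^ (2 ^ (1 + q * 2))    ≡⟨ cong (λ m → 2 ^ (2 ^ (1 + m))) (*-comm q 2) ⟩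
  2 ^ (2 ^ (1 + 2 * q))    ∎
  where
  open ≤-Reasoning
  q≤2^q : q ≤ 2 ^ q
  q≤2^q = <⇒≤ (n<2^n q)
  square : ∀ a → a * 2 * a ≡ 2 * (a * (a * 1))
  square = solve-∀

-- The remainder is at most 32 and hence at most `q`, so `n` is at most `33 * q`.
n≤[n/32]² : ∀ n → 33 ≤ n / 32 → n ≤ (n / 32) ^ 2
n≤[n/32]² n 33≤q = begin
  n                ≡⟨ m≡m%n+[m/n]*n n 32 ⟩
  n % 32 + q * 32  ≤⟨ +-monoˡ-≤ (q * 32) (≤-trans (m%n≤n n 32) (≤-trans (n≤1+n 32) 33≤q)) ⟩
  q + q * 32       ≡⟨ *-suc q 32 ⟨
  q * 33           ≤⟨ *-monoʳ-≤ q 33≤q ⟩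
  q * q            ≡⟨ cong (q *_) (*-identityʳ q) ⟨
  q ^ 2            ∎
  where
  open ≤-Reasoning
  q = n / 32

order≤n : ∀ n → 33 ≤ n / 32 → 20 + 8 * (1 + 2 * (n / 32)) ≤ n
order≤n n 33≤q = begin
  20 + 8 * (1 + 2 * q)  ≡⟨ lhs q ⟩
  -- The additive constant is absorbed by one more `q`; the total of 17 times `q` stays below 32
  -- times `q`.
  28 + 16 * q           ≤⟨ +-monoˡ-≤ (16 * q) (≤-trans (m≤m+n 28 5) 33≤q) ⟩
  q + 16 * q            ≤⟨ +-monoˡ-≤ (16 * q) (m≤n*m q 16) ⟩
  16 * q + 16 * q       ≡⟨ rhs q ⟩
  q * 32                ≤⟨ m/n*n≤m n 32 ⟩
  n                     ∎
  where
  open ≤-Reasoning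
  q = n / 32
  lhs : ∀ q → 20 + 8 * (1 + 2 * q) ≡ 28 + 16 * q
  lhs = solve-∀
  rhs : ∀ q → 16 * q + 16 * q ≡ q * 32
  rhs = solve-∀

proposition43 : ∃[ c ] NonZero (num c) × ∃[ N ]
    (∀ n .{{_ : NonZero n}} → N ≤ n →
    ∃[ k ] Σ (Fin (suc k) → Digraph) λ G →
    (∀ i → order (G i) ≤ n) ×
    ∃[ H ] IsCoreOf H (⨂ G) ×
    fromFrac c *ᴿ (n ^ᴿ (2 ^ᴿ √ n ÷ᴿ √ n)) ≤ᴿ fromℕ (order H))
-- The threshold ensures `33 ≤ n / 32`. Then `q = n / 32` is large enough to dominate the square
-- root of `n`, yet small enough for words of length `1 + 2 * q` to give factors of order at most
-- `n`.
proposition43 = fromℕᶠ 1 , _ , 33 * 32 , λ n 33*32≤n →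
  let q    = n / 32
      33≤q = /-monoˡ-≤ 32 33*32≤n
      n≤q² = n≤[n/32]² n 33≤q
      k , G , order-G , H , H-core , large = large-core (1 + 2 * q)
  in  k , G , (λ i → ≤-trans (≤-reflexive (order-G i)) (order≤n n 33≤q)) , H , H-core ,
      1*x≤ᴿ (n ^ᴿ (2 ^ᴿ √ n ÷ᴿ √ n)) (order H) (target-bounded n q n≤q²)
        (≤-trans (n^2^q≤2^2^[1+2q] n q n≤q²) large)
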